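{- Let $t_j^i=\binom{i}{j}$ for $0\le j\le i$, and let $h_{j,k}^i$ ($0\le k\le i$, $0\le j\le i-k$) be defined by $h_{j,0}^i=t_j^i$ and $h_{j,k}^i=h_{j,k-1}^{i-1}+h_{j,k-1}^{i}+h_{j+1,k-1}^{i}$ for $k\ge 1$. Then for any $0\leq k \leq i$, $0\leq j \leq i-k$, $$h_{j,k}^i=\sum_{\ell=0}^{k}\binom{2\ell+i-k}{\ell+j}\binom{k}{\ell}.$$ -}

module Defs where

open import Data.Nat using (ℕ; zero; suc; _+_)
open import Data.Nat.Combinatorics using (_C_)

t : (i j : ℕ) → ℕ
t i j = i C j

-- h i j k is h_{j,k}^i, meaningful only for k ≤ i and j ≤ i ∸ k. The recurrence
-- stays inside this range, so the filler value 0 at i < k is never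
-- used in computing a value within it.
h : (i j k : ℕ) → ℕ
h i       j zero    = t i j
h zero    j (suc k) = 0
h (suc i) j (suc k) = h i j k + h (suc i) j k + h (suc i) (suc j) k

{-# OPTIONS --safe #-}

-- Writing i = k + n, the sum is the binomial transform Σ_ℓ f(ℓ) C(k,ℓ) of
-- f(ℓ) = C(2ℓ+n, ℓ+j). Pascal's rule on C(k+1,ℓ) turns the transform of order k + 1 of f
-- into the transform of order k of f(ℓ) + f(ℓ+1), and Pascal's rule on f(ℓ+1) splits this
-- into the three summands of the recurrence for h.

module Submission where

open import Data.Nat using (ℕ; zero; suc; _+_; _*_; _∸_; _≤_)
open import Data.Nat.Properties using (+-identityʳ; +-assoc; +-comm; +-suc; *-identityʳ; *-zeroʳ; *-distribˡ-+; *-distribʳ-+; n<1+n; m+[n∸m]≡n; +-∸-assoc)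
open import Data.Nat.Combinatorics using (_C_; nCk+nC[k+1]≡[n+1]C[k+1]; k>n⇒nCk≡0)
open import Data.Nat.Tactic.RingSolver using (solve-∀)
open import Data.List using (map; upTo; applyUpTo)
open import Data.List.Properties using (map-upTo)
open import Data.Nat.ListAction using (sum)
open import Function using (_∘_)
open import Relation.Binary.PropositionalEquality using (_≡_; refl; sym; trans; cong; cong₂; module ≡-Reasoning)
open import Defs

open ≡-Reasoning

-- `applyUpTo` peels off its first term by computation, leaving a sum of `f ∘ suc`, so inductions on
-- the length need no reindexing lemma.
sumUpTo : (ℕ → ℕ) → ℕ → ℕ
sumUpTo f n = sum (applyUpTo f n)

sumUpTo-cong : ∀ {f g} → (∀ ℓ → f ℓ ≡ g ℓ) → ∀ n → sumUpTo f n ≡ sumUpTo g n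
sumUpTo-cong f≗g zero    = refl
sumUpTo-cong f≗g (suc n) = cong₂ _+_ (f≗g 0) (sumUpTo-cong (f≗g ∘ suc) n)

interchange : ∀ a b c d → (a + b) + (c + d) ≡ (a + c) + (b + d)
interchange = solve-∀

sumUpTo-+ : ∀ f g n → sumUpTo (λ ℓ → f ℓ + g ℓ) n ≡ sumUpTo f n + sumUpTo g n
sumUpTo-+ f g zero    = refl
sumUpTo-+ f g (suc n) = trans
  (cong (f 0 + g 0 +_) (sumUpTo-+ (f ∘ suc) (g ∘ suc) n))
  (interchange (f 0) (g 0) _ _)

sumUpTo-last : ∀ f n → sumUpTo f (suc n) ≡ sumUpTo f n + f n
sumUpTo-last f zero    = +-identityʳ (f 0)
sumUpTo-last f (suc n) = trans
  (cong (f 0 +_) (sumUpTo-last (f ∘ suc) n))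
  (sym (+-assoc (f 0) _ _))

binomialTransform : ℕ → (ℕ → ℕ) → ℕ
binomialTransform k f = sumUpTo (λ ℓ → f ℓ * (k C ℓ)) (suc k)

binomialTransform-cong : ∀ k {f g} → (∀ ℓ → f ℓ ≡ g ℓ) →
  binomialTransform k f ≡ binomialTransform k g
binomialTransform-cong k f≗g = sumUpTo-cong (λ ℓ → cong (_* (k C ℓ)) (f≗g ℓ)) (suc k)

binomialTransform-+ : ∀ k f g →
  binomialTransform k (λ ℓ → f ℓ + g ℓ) ≡ binomialTransform k f + binomialTransform k g
binomialTransform-+ k f g = trans
  (sumUpTo-cong (λ ℓ → *-distribʳ-+ (k C ℓ) (f ℓ) (g ℓ)) (suc k))
  (sumUpTo-+ (λ ℓ → f ℓ * (k C ℓ)) (λ ℓ → g ℓ * (k C ℓ)) (suc k))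

-- The extra term, at ℓ = k + 1, carries C(k,k+1) = 0. It appears when a transform of order k + 1 is
-- rewritten with coefficients C(k,ℓ).
binomialTransform-extend : ∀ k f →
  sumUpTo (λ ℓ → f ℓ * (k C ℓ)) (suc (suc k)) ≡ binomialTransform k f
binomialTransform-extend k f = begin
  sumUpTo (λ ℓ → f ℓ * (k C ℓ)) (suc (suc k))      ≡⟨ sumUpTo-last (λ ℓ → f ℓ * (k C ℓ)) (suc k) ⟩
  binomialTransform k f + f (suc k) * (k C suc k)  ≡⟨ cong (λ c → binomialTransform k f + f (suc k) * c) (k>n⇒nCk≡0 (n<1+n k)) ⟩
  binomialTransform k f + f (suc k) * 0            ≡⟨ cong (binomialTransform k f +_) (*-zeroʳ (f (suc k))) ⟩
  binomialTransform k f + 0                        ≡⟨ +-identityʳ _ ⟩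
  binomialTransform k f                            ∎

-- The term ℓ = 0 is kept apart and Pascal's rule splits every other coefficient: the C(k,ℓ+1) parts
-- rejoin the head, the C(k,ℓ) parts form the transform of the shifted sequence.
binomialTransform-suc : ∀ k f →
  binomialTransform (suc k) f ≡ binomialTransform k f + binomialTransform k (f ∘ suc)
binomialTransform-suc k f = begin
  f 0 * 1 + sumUpTo (λ ℓ → f (suc ℓ) * (suc k C suc ℓ)) (suc k)
    ≡⟨ cong (f 0 * 1 +_) (sumUpTo-cong pascal (suc k)) ⟩
  f 0 * 1 + sumUpTo (λ ℓ → f (suc ℓ) * (k C suc ℓ) + f (suc ℓ) * (k C ℓ)) (suc k)
    ≡⟨ cong (f 0 * 1 +_) (sumUpTo-+ (λ ℓ → f (suc ℓ) * (k C suc ℓ)) (λ ℓ → f (suc ℓ) * (k C ℓ)) (suc k)) ⟩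
  f 0 * 1 + (sumUpTo (λ ℓ → f (suc ℓ) * (k C suc ℓ)) (suc k) + binomialTransform k (f ∘ suc))
    -- `k C 0` also computes to 1, so `f 0 * 1` serves as the ℓ = 0 term of the sum with
    -- coefficients C(k,ℓ).
    ≡⟨ +-assoc (f 0 * 1) _ _ ⟨
  sumUpTo (λ ℓ → f ℓ * (k C ℓ)) (suc (suc k)) + binomialTransform k (f ∘ suc)
    ≡⟨ cong (_+ binomialTransform k (f ∘ suc)) (binomialTransform-extend k f) ⟩
  binomialTransform k f + binomialTransform k (f ∘ suc) ∎
  where
  pascal : ∀ ℓ → f (suc ℓ) * (suc k C suc ℓ) ≡ f (suc ℓ) * (k C suc ℓ) + f (suc ℓ) * (k C ℓ)
  pascal ℓ = begin
    f (suc ℓ) * (suc k C suc ℓ)                      ≡⟨ cong (f (suc ℓ) *_) (nCk+nC[k+1]≡[n+1]C[k+1] k ℓ) ⟨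
    f (suc ℓ) * (k C ℓ + k C suc ℓ)                  ≡⟨ cong (f (suc ℓ) *_) (+-comm (k C ℓ) _) ⟩
    f (suc ℓ) * (k C suc ℓ + k C ℓ)                  ≡⟨ *-distribˡ-+ (f (suc ℓ)) _ _ ⟩
    f (suc ℓ) * (k C suc ℓ) + f (suc ℓ) * (k C ℓ)    ∎

-- Each step in ℓ moves two rows down and one column right in Pascal's triangle; n stands for i - k.
diagonal : (n j ℓ : ℕ) → ℕ
diagonal n j ℓ = (2 * ℓ + n) C (ℓ + j)

-- One use of Pascal's rule climbs only one of the two rows, to 2ℓ + (n+1); this is why n grows by
-- one on the right.
diagonal-suc : ∀ n j ℓ →
  diagonal n j (suc ℓ) ≡ diagonal (suc n) j ℓ + diagonal (suc n) (suc j) ℓ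
diagonal-suc n j ℓ = begin
  (2 * suc ℓ + n) C suc (ℓ + j)
    ≡⟨ cong (_C suc (ℓ + j)) (shift ℓ n) ⟩
  suc (2 * ℓ + suc n) C suc (ℓ + j)
    ≡⟨ nCk+nC[k+1]≡[n+1]C[k+1] (2 * ℓ + suc n) (ℓ + j) ⟨
  (2 * ℓ + suc n) C (ℓ + j) + (2 * ℓ + suc n) C suc (ℓ + j)
    ≡⟨ cong (λ m → diagonal (suc n) j ℓ + (2 * ℓ + suc n) C m) (+-suc ℓ j) ⟨
  diagonal (suc n) j ℓ + diagonal (suc n) (suc j) ℓ ∎
  where
  shift : ∀ ℓ n → 2 * suc ℓ + n ≡ suc (2 * ℓ + suc n)
  shift = solve-∀

-- Induction on k with n and j general: in the recurrence, lowering k alone raises n = i - k by one,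
-- while lowering i as well keeps n. Writing i as k + n avoids truncated subtraction.
h≡binomialTransform : ∀ k n j → h (k + n) j k ≡ binomialTransform k (diagonal n j)
h≡binomialTransform zero    n j = sym (trans (+-identityʳ _) (*-identityʳ _))
h≡binomialTransform (suc k) n j = begin
  h (k + n) j k + h (suc (k + n)) j k + h (suc (k + n)) (suc j) k
    ≡⟨ +-assoc (h (k + n) j k) _ _ ⟩
  h (k + n) j k + (h (suc (k + n)) j k + h (suc (k + n)) (suc j) k)
    ≡⟨ cong (λ m → h (k + n) j k + (h m j k + h m (suc j) k)) (+-suc k n) ⟨
  h (k + n) j k + (h (k + suc n) j k + h (k + suc n) (suc j) k)
    ≡⟨ cong₂ _+_ (h≡binomialTransform k n j)
         (cong₂ _+_ (h≡binomialTransform k (suc n) j) (h≡binomialTransform k (suc n) (suc j))) ⟩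
  T (diagonal n j) + (T (diagonal (suc n) j) + T (diagonal (suc n) (suc j)))
    ≡⟨ cong (T (diagonal n j) +_) (binomialTransform-+ k (diagonal (suc n) j) (diagonal (suc n) (suc j))) ⟨
  T (diagonal n j) + T (λ ℓ → diagonal (suc n) j ℓ + diagonal (suc n) (suc j) ℓ)
    ≡⟨ cong (T (diagonal n j) +_) (binomialTransform-cong k (diagonal-suc n j)) ⟨
  T (diagonal n j) + T (diagonal n j ∘ suc)
    ≡⟨ binomialTransform-suc k (diagonal n j) ⟨
  binomialTransform (suc k) (diagonal n j) ∎
  where
  T = binomialTransform k

theorem9 : (i j k : ℕ) → k ≤ i → j ≤ i ∸ k →
    h i j k ≡ sum (map (λ ℓ → ((2 * ℓ + i ∸ k) C (ℓ + j)) * (k C ℓ)) (upTo (suc k)))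
theorem9 i j k k≤i _ = begin
  h i j k                                 ≡⟨ cong (λ m → h m j k) (m+[n∸m]≡n k≤i) ⟨
  h (k + (i ∸ k)) j k                     ≡⟨ h≡binomialTransform k (i ∸ k) j ⟩
  binomialTransform k (diagonal (i ∸ k) j)
    ≡⟨ binomialTransform-cong k (λ ℓ → cong (_C (ℓ + j)) (+-∸-assoc (2 * ℓ) k≤i)) ⟨
  binomialTransform k (λ ℓ → (2 * ℓ + i ∸ k) C (ℓ + j))
    ≡⟨ cong sum (map-upTo _ (suc k)) ⟨
  sum (map (λ ℓ → ((2 * ℓ + i ∸ k) C (ℓ + j)) * (k C ℓ)) (upTo (suc k))) ∎
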